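{- Let $q$ be a prime power and let $1\le m\leq m'$ be integers. Let $\mathcal{C}\subseteq\mathbb{F}_q^{m\times m'}$ be a rank-metric code of size $q^s$ and minimum distance $m$. Then the covering radius $\rho(\mathcal{C})$ is lower bounded by $m-h$, where $h$ is the smallest non-negative integer that satisfies $$(h+1)^2+(m'-m)(h+1)-(s+\log_q(4))>0.$$ In particular, if $q\neq 2,3$, then $$\rho(\mathcal{C})\geq m-\sqrt{s+1}.$$
   Context: A rank-metric code is a (not necessarily linear) subset $\mathcal{C}\subseteq\mathbb{F}_q^{m\times m'}$ with $|\mathcal{C}|\geq2$; its minimum distance is $\min\{\mathrm{rank}(A-B): A,B\in\mathcal{C},\ A\neq B\}$. Its covering radius is $\rho(\mathcal{C})=\max\{\min\{\mathrm{rank}(A-Y):A\in\mathcal{C}\}: Y\in\mathbb{F}_q^{m\times m'}\}$. -}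

module Defs where

open import Level using (0ℓ)
open import Algebra.Structures using (IsCommutativeRing)
open import Data.Fin.Base using (Fin)
open import Data.Integer.Base using (+_; -[1+_])
open import Data.List.Base using (List; length)
open import Data.List.Membership.Propositional using (_∈_)
open import Data.List.Relation.Unary.Unique.Propositional using (Unique)
open import Data.Nat.Base as ℕ using (ℕ)
open import Data.Nat.Primality using (Prime)
open import Data.Product.Base using (∃; ∃₂; _×_)
open import Data.Rational.Unnormalised.Base as ℚ using (ℚᵘ; 0ℚᵘ; ↥_; ↧ₙ_)
open import Data.Sum.Base using (_⊎_)
open import Data.Vec.Base using (Vec; foldr′; map; replicate; zipWith)
open import Function.Bundles using (_↔_; _⇔_)
open import Relation.Binary.PropositionalEquality.Core using (_≡_; _≢_)
open import Relation.Nullary.Negation.Core using (¬_)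
open import Relation.Unary using (Pred)

IsMin IsMax : Pred ℕ 0ℓ → ℕ → Set
IsMin P n = P n × (∀ k → P k → n ℕ.≤ k)
IsMax P n = P n × (∀ k → P k → k ℕ.≤ n)

HasSize : {A : Set} → Pred A 0ℓ → ℕ → Set
HasSize {A} P n =
  ∃ λ (xs : List A) → Unique xs × length xs ≡ n × (∀ x → P x ⇔ x ∈ xs)

IsPrimePower : ℕ → Set
IsPrimePower q = ∃₂ λ p k → Prime p × 1 ℕ.≤ k × q ≡ p ℕ.^ k

record FiniteField (q : ℕ) : Set₁ where
  infixl 7 _*_
  infixl 6 _+_
  infix  8 -_
  field
    Carrier           : Set
    _+_ _*_           : Carrier → Carrier → Carrier
    -_                : Carrier → Carrier
    0# 1#             : Carrier
    isCommutativeRing : IsCommutativeRing _≡_ _+_ _*_ -_ 0# 1#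
    0≢1               : 0# ≢ 1#
    inverse           : ∀ x → x ≢ 0# → ∃ λ y → x * y ≡ 1#
    finite            : Carrier ↔ Fin q

module _ {q : ℕ} (F : FiniteField q) where
  open FiniteField F

  Row : ℕ → Set
  Row n = Vec Carrier n

  Matrix : ℕ → ℕ → Set
  Matrix m n = Vec (Row n) m

  subtract : ∀ {m n} → Matrix m n → Matrix m n → Matrix m n
  subtract = zipWith (zipWith (λ x y → x + - y))

  linearCombination : ∀ {k n} → Vec Carrier k → Vec (Row n) k → Row n
  linearCombination cs vs =
    foldr′ (zipWith _+_) (replicate _ 0#) (zipWith (λ c → map (c *_)) cs vs)

  InSpan : ∀ {k n} → Vec (Row n) k → Row n → Set
  InSpan vs v = ∃ λ cs → linearCombination cs vs ≡ v

  LinearlyIndependent : ∀ {k n} → Vec (Row n) k → Set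
  LinearlyIndependent vs =
    ∀ cs → linearCombination cs vs ≡ replicate _ 0# → cs ≡ replicate _ 0#

  -- HasRank A r: the row space of A has a basis consisting of r vectors.
  HasRank : ∀ {m n} → Matrix m n → ℕ → Set
  HasRank {n = n} A r =
    ∃ λ (b : Vec (Row n) r) →
      LinearlyIndependent b × (∀ v → InSpan A v ⇔ InSpan b v)

  Code : ℕ → ℕ → Set₁
  Code m n = Pred (Matrix m n) 0ℓ

  IsMinimumDistance : ∀ {m n} → Code m n → ℕ → Set
  IsMinimumDistance C =
    IsMin λ r → ∃₂ λ A B → C A × C B × A ≢ B × HasRank (subtract A B) r

  IsDistanceToCode : ∀ {m n} → Code m n → Matrix m n → ℕ → Set
  IsDistanceToCode C Y =
    IsMin λ r → ∃ λ A → C A × HasRank (subtract A Y) r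

  IsCoveringRadius : ∀ {m n} → Code m n → ℕ → Set
  IsCoveringRadius C = IsMax λ d → ∃ λ Y → IsDistanceToCode C Y d

-- A real number x is given by the rationals strictly below it (lower) and
-- strictly above it (upper).  The Dedekind axioms are not fields: every cut
-- below is built from, or assumed equal to, explicit real numbers.
record Cut : Set₁ where
  field
    lower upper : Pred ℚᵘ 0ℓ
open Cut public

infix 4 _≃ᶜ_ _<ᶜ_ _≤ᶜ_
infixl 6 _+ᶜ_ _-ᶜ_
infix 8 -ᶜ_

_≃ᶜ_ _<ᶜ_ _≤ᶜ_ : Cut → Cut → Set
x ≃ᶜ y = ∀ r → (lower x r ⇔ lower y r) × (upper x r ⇔ upper y r)
x <ᶜ y = ∃ λ r → upper x r × lower y r
x ≤ᶜ y = ¬ (y <ᶜ x)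

fromℕ : ℕ → Cut
fromℕ n .lower r = r ℚ.< + n ℚ./ 1
fromℕ n .upper r = + n ℚ./ 1 ℚ.< r

_+ᶜ_ : Cut → Cut → Cut
(x +ᶜ y) .lower r = ∃₂ λ s t → lower x s × lower y t × r ℚ.≃ s ℚ.+ t
(x +ᶜ y) .upper r = ∃₂ λ s t → upper x s × upper y t × r ℚ.≃ s ℚ.+ t

-ᶜ_ : Cut → Cut
(-ᶜ x) .lower r = upper x (ℚ.- r)
(-ᶜ x) .upper r = lower x (ℚ.- r)

_-ᶜ_ : Cut → Cut → Cut
x -ᶜ y = x +ᶜ -ᶜ y

-- The square root of a nonnegative real.
√ᶜ_ : Cut → Cut
(√ᶜ x) .lower r = r ℚ.< 0ℚᵘ ⊎ lower x (r ℚ.* r)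
(√ᶜ x) .upper r = 0ℚᵘ ℚ.< r × upper x (r ℚ.* r)

-- q ^ (a / b) < n and n < q ^ (a / b) for q ≥ 2, n ≥ 1: raise both sides to
-- the power b > 0 and, if a < 0, multiply by q ^ ∣ a ∣.
PowerBelow PowerAbove : ℕ → ℕ → ℚᵘ → Set
PowerBelow q n r with ↥ r
... | + a      = q ℕ.^ a ℕ.< n ℕ.^ ↧ₙ r
... | -[1+ a ] = 1 ℕ.< n ℕ.^ ↧ₙ r ℕ.* q ℕ.^ ℕ.suc a
PowerAbove q n r with ↥ r
... | + a      = n ℕ.^ ↧ₙ r ℕ.< q ℕ.^ a
... | -[1+ a ] = n ℕ.^ ↧ₙ r ℕ.* q ℕ.^ ℕ.suc a ℕ.< 1

-- log q n is the real number s with q ^ s = n.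
log : ℕ → ℕ → Cut
log q n .lower = PowerBelow q n
log q n .upper = PowerAbove q n

{-# OPTIONS --safe #-}
module Submission where

open import Defs
open import Data.Integer.Base using (+_) renaming (_-_ to _-ℤ_; _≤_ to _≤ℤ_)
open import Data.Nat.Base using (ℕ; _+_; _*_; _∸_; _^_; _≤_)
open import Data.Product.Base using (_×_)
open import Relation.Binary.PropositionalEquality.Core using (_≢_)

open import Algebra.Bundles using (CommutativeRing)
import Algebra.Properties.Ring as RingProperties
open import Data.Fin.Base using (Fin; zero; suc)
import Data.Fin.Properties as Fin
open import Data.Integer.Base as ℤ using (-[1+_])
import Data.Integer.Properties as ℤ
open import Data.List.Base
  using (List; []; _∷_; [_]; length; lookup; cartesianProductWith; map; _++_; allFin)
import Data.List.Membership.DecPropositional as DecMembership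
open import Data.List.Membership.Propositional using (_∈_)
open import Data.List.Membership.Propositional.Properties
  using (∈-lookup; ∈-cartesianProductWith⁺; ∈-++⁺ˡ; ∈-++⁺ʳ; ∈-map⁺; ∈-allFin)
import Data.List.Membership.Setoid.Properties as ∈ₛ
open import Data.List.Properties using (length-++; length-map; length-tabulate)
import Data.List.Relation.Unary.All as ListAll
open import Data.List.Relation.Unary.AllPairs using ([]; _∷_)
open import Data.List.Relation.Unary.Any using (here; index)
open import Data.List.Relation.Unary.Unique.Propositional using (Unique)
open import Data.List.Relation.Unary.Unique.Propositional.Properties
  using (cartesianProductWith⁺; map⁺; allFin⁺)
open import Data.Nat.Base as ℕ
  using (zero; suc; _<_; z≤n; s≤s; z<s; NonZero; >-nonZero)
open import Data.Nat.Induction using (<-rec)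
import Data.Nat.Properties as ℕ
open import Data.Nat.Tactic.RingSolver using (solve-∀)
open import Data.Product.Base using (_,_; ∃; ∃₂; proj₁; proj₂)
open import Data.Rational.Unnormalised.Base as ℚ using (mkℚᵘ; 0ℚᵘ)
import Data.Rational.Unnormalised.Properties as ℚ
open import Data.Sum.Base using (inj₁; inj₂)
open import Data.Vec.Base as Vec using (Vec; []; _∷_; zipWith; replicate)
open import Data.Vec.Properties
  using (∷-injective; ≡-dec; zipWith-identityˡ; zipWith-identityʳ; zipWith-inverseʳ;
         map-cong; map-∘; map-id; map-const)
open import Data.Vec.Relation.Unary.All as All using (All; []; _∷_)
open import Effect.Monad using (RawMonad)
open import Function.Base using (_∘_; case_of_)
open import Function.Bundles using (mk⇔; module Equivalence; module Inverse)
open import Function.Properties.Inverse using (Inverse⇒Injection)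
open import Level using (0ℓ)
open import Relation.Binary.Definitions using (DecidableEquality)
open import Relation.Binary.PropositionalEquality
  using (_≡_; refl; sym; trans; cong; cong₂; subst; subst₂; setoid; ≢-sym; module ≡-Reasoning)
open import Relation.Nullary.Decidable
  using (yes; no; via-injection; decidable-stable; ¬¬-excluded-middle)
open import Relation.Nullary.Negation using (¬_; contradiction; ¬¬-Monad)
open import Relation.Unary using (Pred)

-- Sphere covering.  A matrix with m rows in F^n whose rows are spanned by r ≤ m
-- vectors is built row by row, each new row being either a combination of the
-- generators so far (q^r choices) or a new generator (q^n choices); hence there
-- are at most q^(nr) [m choose r]_q ≤ 4 q^(nr + r(m-r)) of them.  The balls of
-- radius ρ around the N codewords cover everything, so with d = m - ρ this gives
-- q^(d² + (m'-m) d) ≤ 4 N.  Taking logarithms yields both bounds, the second one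
-- because 4 ≤ q.

-- Counting with duplicate-free lists.

private variable
  A B D : Set

lookup-injective : ∀ {xs : List A} → Unique xs →
                   ∀ {i j} → lookup xs i ≡ lookup xs j → i ≡ j
lookup-injective (_ ∷ _)   {zero}  {zero}  _  = refl
lookup-injective (x∉ ∷ _)  {zero}  {suc j} eq = contradiction eq (ListAll.lookup x∉ (∈-lookup j))
lookup-injective (x∉ ∷ _)  {suc i} {zero}  eq = contradiction (sym eq) (ListAll.lookup x∉ (∈-lookup i))
lookup-injective (_ ∷ xs!) {suc i} {suc j} eq = cong suc (lookup-injective xs! eq)

-- Pigeonhole principle: sending a position of `xs` to the position in `ys` where its entry is found
-- is injective, because `xs` has no repetitions. Nothing is asked of `ys`, so an enumeration used
-- as an upper bound may contain duplicates.
Unique-⊆⇒length-≤ : ∀ {xs ys : List A} → Unique xs → (∀ {x} → x ∈ xs → x ∈ ys) →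
                    length xs ≤ length ys
Unique-⊆⇒length-≤ {xs = xs} xs! xs⊆ys = Fin.injective⇒≤ {f = λ i → index (xs⊆ys (∈-lookup i))}
  λ {i} {j} eq → lookup-injective xs!
    (∈ₛ.index-injective (setoid _) (xs⊆ys (∈-lookup {xs = xs} i)) (xs⊆ys (∈-lookup j)) eq)

length-cartesianProductWith : ∀ (f : A → B → D) xs ys →
  length (cartesianProductWith f xs ys) ≡ length xs * length ys
length-cartesianProductWith f []       ys = refl
length-cartesianProductWith f (x ∷ xs) ys = begin
  length (map (f x) ys ++ cartesianProductWith f xs ys)
    ≡⟨ length-++ (map (f x) ys) ⟩
  length (map (f x) ys) + length (cartesianProductWith f xs ys)
    ≡⟨ cong₂ _+_ (length-map (f x) ys) (length-cartesianProductWith f xs ys) ⟩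
  length ys + length xs * length ys ∎
  where open ≡-Reasoning

-- Serves twice: over the field elements it lists rows, and over rows it lists matrices.
vectors : List A → ∀ n → List (Vec A n)
vectors xs zero    = [ [] ]
vectors xs (suc n) = cartesianProductWith _∷_ xs (vectors xs n)

length-vectors : ∀ (xs : List A) n → length (vectors xs n) ≡ length xs ^ n
length-vectors xs zero    = refl
length-vectors xs (suc n) = trans (length-cartesianProductWith _∷_ xs (vectors xs n))
  (cong (length xs *_) (length-vectors xs n))

∈-vectors : ∀ {xs : List A} → (∀ x → x ∈ xs) → ∀ {n} (v : Vec A n) → v ∈ vectors xs n
∈-vectors ∈xs []      = here refl
∈-vectors ∈xs (x ∷ v) = ∈-cartesianProductWith⁺ _∷_ (∈xs x) (∈-vectors ∈xs v)

vectors-unique : ∀ {xs : List A} → Unique xs → ∀ n → Unique (vectors xs n)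
vectors-unique xs! zero    = ListAll.[] ∷ []
vectors-unique xs! (suc n) =
  cartesianProductWith⁺ _∷_ ∷-injective xs! (vectors-unique xs! n)

-- Gaussian binomial coefficients and their upper bound.

-- Of the two q-Pascal rules, the one whose summands match the two branches of `bounded`.
q-binomial : ℕ → ℕ → ℕ → ℕ
q-binomial q m       zero    = 1
q-binomial q zero    (suc r) = 0
q-binomial q (suc m) (suc r) = q ^ suc r * q-binomial q m (suc r) + q-binomial q m r

q-binomial-< : ∀ q {m r} → m < r → q-binomial q m r ≡ 0
q-binomial-< q {zero}  {suc r} _ = refl
q-binomial-< q {suc m} {suc r} (s≤s m<r)
  rewrite q-binomial-< q m<r | q-binomial-< q (ℕ.m<n⇒m<1+n m<r) =
    trans (ℕ.+-identityʳ _) (ℕ.*-zeroʳ (q ^ suc r))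

q-binomial-n-n : ∀ q r → q-binomial q r r ≡ 1
q-binomial-n-n q zero = refl
q-binomial-n-n q (suc r)
  rewrite q-binomial-n-n q r | q-binomial-< q (ℕ.n<1+n r) = cong (_+ 1) (ℕ.*-zeroʳ (q ^ suc r))

^-distribʳ-* : ∀ m n o → (m * n) ^ o ≡ m ^ o * n ^ o
^-distribʳ-* m n zero    = refl
^-distribʳ-* m n (suc o) =
  trans (cong (m * n *_) (^-distribʳ-* m n o)) (lemma m n (m ^ o) (n ^ o))
  where
  lemma : ∀ a b c d → a * b * (c * d) ≡ a * c * (b * d)
  lemma = solve-∀

-- Induction step of `q-binomial-bound` on `r` in codimension 1, with R = q^(r+1): the first summand
-- of the q-Pascal rule is then `R` itself, and what remains is q + 6 ≤ 4q.
q-binomial-step₁ : ∀ {q b} R → 2 ≤ q → (q + 2) * b ≤ 4 * R → (q + 2) * (R + b) ≤ 4 * (q * R)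
q-binomial-step₁ {q} {b} R 2≤q hb = begin
  (q + 2) * (R + b)           ≡⟨ ℕ.*-distribˡ-+ (q + 2) R b ⟩
  (q + 2) * R + (q + 2) * b   ≤⟨ ℕ.+-monoʳ-≤ ((q + 2) * R) hb ⟩
  (q + 2) * R + 4 * R         ≡⟨ lhs q R ⟩
  (q + 3 * 2) * R             ≤⟨ ℕ.*-monoˡ-≤ R (ℕ.+-monoʳ-≤ q (ℕ.*-monoʳ-≤ 3 2≤q)) ⟩
  (q + 3 * q) * R             ≡⟨ ℕ.*-assoc 4 q R ⟩
  4 * (q * R)                 ∎
  where
  open ℕ.≤-Reasoning
  lhs : ∀ q R → (q + 2) * R + 4 * R ≡ (q + 3 * 2) * R
  lhs = solve-∀

-- Induction step of `q-binomial-bound` in higher codimension, with Q = q^(d+1), R = q^(r+1) and P =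
-- Q^(r+1). Multiplying by Q + 2 makes both hypotheses applicable without division; after cancelling
-- common terms the claim is 3Q + 2 ≤ 2qQ.
q-binomial-step₂ : ∀ {q Q a b} R P → 2 ≤ q → 2 ≤ Q →
  (Q + 2) * a ≤ 4 * (Q * P) → (q * Q + 2) * b ≤ 4 * (R * P) →
  (q * Q + 2) * (R * a + b) ≤ 4 * (q * R * (Q * P))
q-binomial-step₂ {q} {Q} {a} {b} R P 2≤q 2≤Q ha hb = ℕ.*-cancelˡ-≤ (suc (suc Q)) (begin
  (2 + Q) * ((q * Q + 2) * (R * a + b))
    ≡⟨ expand q Q R a b ⟩
  (q * Q + 2) * R * ((Q + 2) * a) + (Q + 2) * ((q * Q + 2) * b)
    ≤⟨ ℕ.+-mono-≤ (ℕ.*-monoʳ-≤ ((q * Q + 2) * R) ha) (ℕ.*-monoʳ-≤ (Q + 2) hb) ⟩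
  (q * Q + 2) * R * (4 * (Q * P)) + (Q + 2) * (4 * (R * P))
    ≡⟨ collect q Q R P ⟩
  4 * R * P * (q * Q * Q + (3 * Q + 2))
    ≤⟨ ℕ.*-monoʳ-≤ (4 * R * P) (ℕ.+-monoʳ-≤ (q * Q * Q) quadratic) ⟩
  4 * R * P * (q * Q * Q + 2 * q * Q)
    ≡⟨ regroup q Q R P ⟩
  (2 + Q) * (4 * (q * R * (Q * P))) ∎)
  where
  open ℕ.≤-Reasoning
  expand : ∀ q Q R a b → (2 + Q) * ((q * Q + 2) * (R * a + b)) ≡
           (q * Q + 2) * R * ((Q + 2) * a) + (Q + 2) * ((q * Q + 2) * b)
  expand = solve-∀
  collect : ∀ q Q R P → (q * Q + 2) * R * (4 * (Q * P)) + (Q + 2) * (4 * (R * P)) ≡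
            4 * R * P * (q * Q * Q + (3 * Q + 2))
  collect = solve-∀
  regroup : ∀ q Q R P → 4 * R * P * (q * Q * Q + 2 * q * Q) ≡ (2 + Q) * (4 * (q * R * (Q * P)))
  regroup = solve-∀
  quadratic : 3 * Q + 2 ≤ 2 * q * Q
  quadratic = begin
    3 * Q + 2 ≤⟨ ℕ.+-monoʳ-≤ (3 * Q) 2≤Q ⟩
    3 * Q + Q ≡⟨ ℕ.+-comm (3 * Q) Q ⟩
    2 * 2 * Q ≤⟨ ℕ.*-monoˡ-≤ Q (ℕ.*-monoʳ-≤ 2 2≤q) ⟩
    2 * q * Q ∎

-- The summand 2 is what makes the induction close: it encodes
-- ∏ᵢ (1 - q⁻ⁱ)⁻¹ ≤ 4 / (1 + 2 q⁻ᵈ), the product being over 1 ≤ i ≤ d.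
q-binomial-bound : ∀ {q} → 2 ≤ q → ∀ r d →
  (q ^ suc d + 2) * q-binomial q (r + suc d) r ≤ 4 * (q ^ suc d) ^ suc r
q-binomial-bound {q} 2≤q = bound
  where
  open ℕ.≤-Reasoning
  instance _ = >-nonZero (ℕ.<-trans z<s 2≤q)

  2≤q^ : ∀ d → 2 ≤ q ^ suc d
  2≤q^ d = begin
    2         ≤⟨ 2≤q ⟩
    q         ≡⟨ ℕ.*-identityʳ q ⟨
    q ^ 1     ≤⟨ ℕ.^-monoʳ-≤ q (s≤s (z≤n {d})) ⟩
    q ^ suc d ∎

  bound : ∀ r d → (q ^ suc d + 2) * q-binomial q (r + suc d) r ≤ 4 * (q ^ suc d) ^ suc r
  bound zero d = begin
    (Q + 2) * 1       ≡⟨ ℕ.*-identityʳ (Q + 2) ⟩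
    Q + 2             ≤⟨ ℕ.+-monoʳ-≤ Q (2≤q^ d) ⟩
    Q + Q             ≡⟨ cong (λ x → Q + x) (ℕ.+-identityʳ Q) ⟨
    2 * Q             ≤⟨ ℕ.*-monoˡ-≤ Q (s≤s (s≤s (z≤n {2}))) ⟩
    4 * Q             ≡⟨ cong (4 *_) (ℕ.*-identityʳ Q) ⟨
    4 * Q ^ 1         ∎
    where Q = q ^ suc d
  bound (suc r) zero = begin
    (q ^ 1 + 2) * (q ^ suc r * q-binomial q (r + 1) (suc r) + b)
      ≡⟨ cong₂ (λ x y → (x + 2) * (q ^ suc r * y + b)) (ℕ.*-identityʳ q)
           (trans (cong (λ n → q-binomial q n (suc r)) (ℕ.+-comm r 1)) (q-binomial-n-n q (suc r))) ⟩
    (q + 2) * (q ^ suc r * 1 + b)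
      ≡⟨ cong (λ x → (q + 2) * (x + b)) (ℕ.*-identityʳ (q ^ suc r)) ⟩
    (q + 2) * (q ^ suc r + b)
      ≤⟨ q-binomial-step₁ (q ^ suc r) 2≤q
           (subst (λ x → (x + 2) * b ≤ 4 * x ^ suc r) (ℕ.*-identityʳ q) (bound r zero)) ⟩
    4 * q ^ suc (suc r)
      ≡⟨ cong (λ x → 4 * x ^ suc (suc r)) (ℕ.*-identityʳ q) ⟨
    4 * (q ^ 1) ^ suc (suc r) ∎
    where b = q-binomial q (r + 1) r
  bound (suc r) (suc d) = begin
    (q * Q + 2) * (q ^ suc r * q-binomial q (r + suc (suc d)) (suc r) + b)
      ≡⟨ cong (λ n → (q * Q + 2) * (q ^ suc r * q-binomial q n (suc r) + b)) (ℕ.+-suc r (suc d)) ⟩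
    (q * Q + 2) * (q ^ suc r * q-binomial q (suc r + suc d) (suc r) + b)
      ≤⟨ q-binomial-step₂ {q = q} {Q = Q} (q ^ suc r) (Q ^ suc r) 2≤q (2≤q^ d) (bound (suc r) d)
           (subst (λ x → (q * Q + 2) * b ≤ 4 * x) (^-distribʳ-* q Q (suc r)) (bound r (suc d))) ⟩
    4 * (q ^ suc (suc r) * Q ^ suc (suc r))
      ≡⟨ cong (4 *_) (^-distribʳ-* q Q (suc (suc r))) ⟨
    4 * (q * Q) ^ suc (suc r) ∎
    where
    Q = q ^ suc d
    b = q-binomial q (r + suc (suc d)) r

-- In positive codimension the summand 2 is dropped from `q-binomial-bound` and one factor `Q`
-- cancelled. Codimension 0 is treated apart, the coefficient being 1 there.
q-binomial≤ : ∀ {q} → 2 ≤ q → ∀ r d → q-binomial q (r + d) r ≤ 4 * q ^ (d * r)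
q-binomial≤ {q} 2≤q r zero rewrite ℕ.+-identityʳ r | q-binomial-n-n q r = s≤s z≤n
q-binomial≤ {q} 2≤q r (suc d) = ℕ.*-cancelˡ-≤ Q (begin
  Q * b                ≤⟨ ℕ.*-monoˡ-≤ b (ℕ.m≤m+n Q 2) ⟩
  (Q + 2) * b          ≤⟨ q-binomial-bound 2≤q r d ⟩
  4 * (Q * Q ^ r)      ≡⟨ swap 4 Q (Q ^ r) ⟩
  Q * (4 * Q ^ r)      ≡⟨ cong (λ x → Q * (4 * x)) (ℕ.^-*-assoc q (suc d) r) ⟩
  Q * (4 * q ^ (suc d * r)) ∎)
  where
  open ℕ.≤-Reasoning
  Q = q ^ suc d
  b = q-binomial q (r + suc d) r
  swap : ∀ x y z → x * (y * z) ≡ y * (x * z)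
  swap = solve-∀
  instance
    _ = >-nonZero (ℕ.<-trans z<s 2≤q)
    _ = ℕ.m^n≢0 q (suc d)

-- Classical reasoning under double negation.

open RawMonad (¬¬-Monad {0ℓ}) using (_>>=_; pure)

-- Strong induction on `n`: either a smaller witness exists or `n` is least. As `P` is not assumed
-- decidable, this case split is available only under double negation.
¬¬-least : ∀ {P : Pred ℕ 0ℓ} n → P n → ¬ ¬ ∃ (IsMin P)
¬¬-least {P} = <-rec (λ n → P n → ¬ ¬ ∃ (IsMin P)) λ n least Pn →
  ¬¬-excluded-middle {A = ∃ λ k → k < n × P k} >>= λ where
    (yes (k , k<n , Pk)) → least k<n Pk
    (no  none)           → pure (n , Pn , λ k Pk → ℕ.≮⇒≥ λ k<n → none (k , k<n , Pk))

-- Spans and linear independence over a finite field.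

module LinearAlgebra {q : ℕ} (F : FiniteField q) where
  open FiniteField F renaming (_+_ to _+ᶠ_; _*_ to _*ᶠ_; -_ to -ᶠ_)

  commutativeRing : CommutativeRing 0ℓ 0ℓ
  commutativeRing = record { isCommutativeRing = isCommutativeRing }

  open CommutativeRing commutativeRing
    using (ring; +-assoc; +-comm; +-identityˡ; +-identityʳ; -‿inverseʳ;
           *-assoc; *-comm; *-identityˡ; zeroˡ; zeroʳ; distribˡ; distribʳ)
  open RingProperties ring

  private variable
    k m n r : ℕ

  infixl 6 _⊕_
  infixr 7 _⊙_

  _⊕_ : Row F n → Row F n → Row F n
  _⊕_ = zipWith _+ᶠ_

  _⊙_ : Carrier → Row F n → Row F n
  c ⊙ v = Vec.map (c *ᶠ_) v

  𝟎 : Row F n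
  𝟎 = replicate _ 0#

  L : Vec Carrier k → Vec (Row F n) k → Row F n
  L = linearCombination F

  ⊕-interchange : (u v w x : Row F n) → (u ⊕ v) ⊕ (w ⊕ x) ≡ (u ⊕ w) ⊕ (v ⊕ x)
  ⊕-interchange []      []      []      []      = refl
  ⊕-interchange (a ∷ u) (b ∷ v) (c ∷ w) (d ∷ x) = cong₂ _∷_ eq (⊕-interchange u v w x)
    where
    open ≡-Reasoning
    eq : (a +ᶠ b) +ᶠ (c +ᶠ d) ≡ (a +ᶠ c) +ᶠ (b +ᶠ d)
    eq = begin
      (a +ᶠ b) +ᶠ (c +ᶠ d) ≡⟨ +-assoc a b (c +ᶠ d) ⟩
      a +ᶠ (b +ᶠ (c +ᶠ d)) ≡⟨ cong (a +ᶠ_) (+-assoc b c d) ⟨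
      a +ᶠ ((b +ᶠ c) +ᶠ d) ≡⟨ cong (λ x → a +ᶠ (x +ᶠ d)) (+-comm b c) ⟩
      a +ᶠ ((c +ᶠ b) +ᶠ d) ≡⟨ cong (a +ᶠ_) (+-assoc c b d) ⟩
      a +ᶠ (c +ᶠ (b +ᶠ d)) ≡⟨ +-assoc a c (b +ᶠ d) ⟨
      (a +ᶠ c) +ᶠ (b +ᶠ d) ∎

  ⊙-distribˡ : ∀ c (v w : Row F n) → c ⊙ (v ⊕ w) ≡ c ⊙ v ⊕ c ⊙ w
  ⊙-distribˡ c []      []      = refl
  ⊙-distribˡ c (x ∷ v) (y ∷ w) = cong₂ _∷_ (distribˡ c x y) (⊙-distribˡ c v w)

  ⊙-distribʳ : ∀ c d (v : Row F n) → (c +ᶠ d) ⊙ v ≡ c ⊙ v ⊕ d ⊙ v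
  ⊙-distribʳ c d []      = refl
  ⊙-distribʳ c d (x ∷ v) = cong₂ _∷_ (distribʳ x c d) (⊙-distribʳ c d v)

  ⊙-assoc : ∀ c d (v : Row F n) → (c *ᶠ d) ⊙ v ≡ c ⊙ d ⊙ v
  ⊙-assoc c d v = trans (map-cong (*-assoc c d) v) (map-∘ (c *ᶠ_) (d *ᶠ_) v)

  ⊙-zeroˡ : (v : Row F n) → 0# ⊙ v ≡ 𝟎
  ⊙-zeroˡ v = trans (map-cong zeroˡ v) (map-const v 0#)

  ⊙-zeroʳ : ∀ c n → c ⊙ 𝟎 {n} ≡ 𝟎
  ⊙-zeroʳ c zero    = refl
  ⊙-zeroʳ c (suc n) = cong₂ _∷_ (zeroʳ c) (⊙-zeroʳ c n)

  ⊙-identity : (v : Row F n) → 1# ⊙ v ≡ v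
  ⊙-identity v = trans (map-cong *-identityˡ v) (map-id v)

  L-⊕ : ∀ (cs ds : Vec Carrier k) (vs : Vec (Row F n) k) → L (cs ⊕ ds) vs ≡ L cs vs ⊕ L ds vs
  L-⊕ []       []       []       = sym (zipWith-identityˡ +-identityˡ 𝟎)
  L-⊕ (c ∷ cs) (d ∷ ds) (v ∷ vs) =
    trans (cong₂ _⊕_ (⊙-distribʳ c d v) (L-⊕ cs ds vs))
          (⊕-interchange (c ⊙ v) (d ⊙ v) (L cs vs) (L ds vs))

  L-⊙ : ∀ c (cs : Vec Carrier k) (vs : Vec (Row F n) k) → L (c ⊙ cs) vs ≡ c ⊙ L cs vs
  L-⊙ c []       []       = sym (⊙-zeroʳ c _)
  L-⊙ c (d ∷ cs) (v ∷ vs) =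
    trans (cong₂ _⊕_ (⊙-assoc c d v) (L-⊙ c cs vs)) (sym (⊙-distribˡ c (d ⊙ v) (L cs vs)))

  L-𝟎 : (vs : Vec (Row F n) k) → L 𝟎 vs ≡ 𝟎
  L-𝟎 []       = refl
  L-𝟎 (v ∷ vs) = trans (cong₂ _⊕_ (⊙-zeroˡ v) (L-𝟎 vs)) (zipWith-identityˡ +-identityˡ 𝟎)

  InSpan-⊕ : ∀ {vs : Vec (Row F n) k} {v w} → InSpan F vs v → InSpan F vs w → InSpan F vs (v ⊕ w)
  InSpan-⊕ {vs = vs} (cs , refl) (ds , refl) = cs ⊕ ds , L-⊕ cs ds vs

  InSpan-⊙ : ∀ {vs : Vec (Row F n) k} {v} c → InSpan F vs v → InSpan F vs (c ⊙ v)
  InSpan-⊙ {vs = vs} c (cs , refl) = c ⊙ cs , L-⊙ c cs vs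

  InSpan-here : ∀ (v : Row F n) (vs : Vec (Row F n) k) → InSpan F (v ∷ vs) v
  InSpan-here v vs =
    1# ∷ 𝟎 , trans (cong₂ _⊕_ (⊙-identity v) (L-𝟎 vs)) (zipWith-identityʳ +-identityʳ v)

  InSpan-there : ∀ (w : Row F n) {vs : Vec (Row F n) k} {v} → InSpan F vs v → InSpan F (w ∷ vs) v
  InSpan-there w {vs} (cs , refl) =
    0# ∷ cs , trans (cong (_⊕ L cs vs) (⊙-zeroˡ w)) (zipWith-identityˡ +-identityˡ (L cs vs))

  rows-InSpan : (vs : Vec (Row F n) k) → All (InSpan F vs) vs
  rows-InSpan []       = []
  rows-InSpan (v ∷ vs) = InSpan-here v vs ∷ All.map (InSpan-there v) (rows-InSpan vs)

  InSpan-trans : ∀ {us : Vec (Row F n) k} {vs : Vec (Row F n) m} → All (InSpan F us) vs →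
                 ∀ {w} → InSpan F vs w → InSpan F us w
  InSpan-trans {us = us} []       ([] , refl)     = 𝟎 , L-𝟎 us
  InSpan-trans           (v ∷ vs) (c ∷ cs , refl) =
    InSpan-⊕ (InSpan-⊙ c v) (InSpan-trans vs (cs , refl))

  -- Subtraction is written as adding a multiple by -1, so that the linearity laws `L-⊕` and `L-⊙`
  -- apply to it directly.
  difference-𝟎⇒≡ : (v w : Row F n) → v ⊕ (-ᶠ 1#) ⊙ w ≡ 𝟎 → v ≡ w
  difference-𝟎⇒≡ []      []      _  = refl
  difference-𝟎⇒≡ (x ∷ v) (y ∷ w) eq = cong₂ _∷_
    (x∙y⁻¹≈ε⇒x≈y x y (trans (cong (x +ᶠ_) (sym (-1*x≈-x y))) (cong Vec.head eq)))
    (difference-𝟎⇒≡ v w (cong Vec.tail eq))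

  ⊕-1⊙ : (v : Row F n) → v ⊕ (-ᶠ 1#) ⊙ v ≡ 𝟎
  ⊕-1⊙ v = trans (cong (v ⊕_) (map-cong -1*x≈-x v)) (zipWith-inverseʳ -‿inverseʳ v)

  LinearlyIndependent⇒injective : ∀ {vs : Vec (Row F n) k} → LinearlyIndependent F vs →
    ∀ cs ds → L cs vs ≡ L ds vs → cs ≡ ds
  LinearlyIndependent⇒injective {vs = vs} ind cs ds eq = difference-𝟎⇒≡ cs ds (ind _ (begin
    L (cs ⊕ (-ᶠ 1#) ⊙ ds) vs        ≡⟨ L-⊕ cs _ vs ⟩
    L cs vs ⊕ L ((-ᶠ 1#) ⊙ ds) vs   ≡⟨ cong₂ _⊕_ eq (L-⊙ (-ᶠ 1#) ds vs) ⟩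
    L ds vs ⊕ (-ᶠ 1#) ⊙ L ds vs     ≡⟨ ⊕-1⊙ (L ds vs) ⟩
    𝟎                               ∎))
    where open ≡-Reasoning

  _≟_ : DecidableEquality Carrier
  _≟_ = via-injection (Inverse⇒Injection finite) Fin._≟_

  LinearlyIndependent-∷ : ∀ {v : Row F n} {vs : Vec (Row F n) k} → ¬ InSpan F vs v →
    LinearlyIndependent F vs → LinearlyIndependent F (v ∷ vs)
  LinearlyIndependent-∷ {v = v} {vs} v∉ ind (c ∷ cs) eq with c ≟ 0#
  ... | yes refl = cong (0# ∷_) (ind cs (begin
    L cs vs              ≡⟨ zipWith-identityˡ +-identityˡ (L cs vs) ⟨
    𝟎 ⊕ L cs vs          ≡⟨ cong (_⊕ L cs vs) (⊙-zeroˡ v) ⟨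
    0# ⊙ v ⊕ L cs vs     ≡⟨ eq ⟩
    𝟎                    ∎))
    where open ≡-Reasoning
  -- A nonzero leading coefficient would allow solving for `v`: the relation puts `c ⊙ v` in the
  -- span of `vs`, and scaling by the inverse of `c` puts `v` there.
  ... | no c≢0 = contradiction (InSpan-solve (c ⊙ v) (cs , refl) eq) v∉′
    where
    c⁻¹ = proj₁ (inverse c c≢0)
    InSpan-solve : ∀ w → InSpan F vs (L cs vs) → w ⊕ L cs vs ≡ 𝟎 → InSpan F vs w
    InSpan-solve w L∈ eq = subst (InSpan F vs)
      (sym (difference-𝟎⇒≡ w _ (trans (cong (w ⊕_) double) eq))) (InSpan-⊙ (-ᶠ 1#) L∈)
      where
      -- `difference-𝟎⇒≡` subtracts its second argument, which here is already -1 times `L cs vs`,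
      -- so the two signs have to cancel.
      double : (-ᶠ 1#) ⊙ (-ᶠ 1#) ⊙ L cs vs ≡ L cs vs
      double = trans (sym (⊙-assoc (-ᶠ 1#) (-ᶠ 1#) _))
        (trans (cong (_⊙ L cs vs) (trans (-1*x≈-x (-ᶠ 1#)) (-‿involutive 1#))) (⊙-identity _))
    v∉′ : ¬ InSpan F vs (c ⊙ v)
    v∉′ cv∈ = v∉ (subst (InSpan F vs)
      (trans (sym (⊙-assoc c⁻¹ c v))
        (trans (cong (_⊙ v) (trans (*-comm c⁻¹ c) (proj₂ (inverse c c≢0)))) (⊙-identity v)))
      (InSpan-⊙ c⁻¹ cv∈))

  -- Spans are not decided here, so ranks exist only up to double negation; it is
  -- discharged in sphere-covering, where the goal is decidable list membership.
  ¬¬-HasRank : (M : Matrix F m n) → ¬ ¬ ∃ (HasRank F M)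
  ¬¬-HasRank []      = pure (0 , [] , (λ { [] _ → refl }) , λ v → mk⇔ (λ x → x) (λ x → x))
  ¬¬-HasRank (v ∷ M) = do
    (k , b , ind , M⇔b) ← ¬¬-HasRank M
    let M⊆b = λ {w} → Equivalence.to (M⇔b w)
        b⊆M = λ {w} → Equivalence.from (M⇔b w)
        M∈b = All.map M⊆b (rows-InSpan M)
        b∈M = All.map b⊆M (rows-InSpan b)
    ¬¬-excluded-middle >>= λ where
      (yes v∈M) → pure (k , b , ind , λ w → mk⇔
        (InSpan-trans (M⊆b v∈M ∷ M∈b))
        (InSpan-trans (All.map (InSpan-there v) b∈M)))
      (no v∉M) → pure (suc k , v ∷ b , LinearlyIndependent-∷ (v∉M ∘ b⊆M) ind , λ w → mk⇔
        (InSpan-trans (InSpan-here v b ∷ All.map (InSpan-there v) M∈b))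
        (InSpan-trans (InSpan-here v M ∷ All.map (InSpan-there v) b∈M)))

  -- Enumeration of the field and its tuples, and comparison of dimensions.

  elements : List Carrier
  elements = map (Inverse.from finite) (allFin q)

  length-elements : length elements ≡ q
  length-elements = trans (length-map _ (allFin q)) (length-tabulate (λ i → i))

  elements-unique : Unique elements
  elements-unique = map⁺ (λ {x} {y} eq → trans (sym (Inverse.strictlyInverseˡ finite x))
    (trans (cong (Inverse.to finite) eq) (Inverse.strictlyInverseˡ finite y))) (allFin⁺ q)

  ∈-elements : ∀ x → x ∈ elements
  ∈-elements x = subst (_∈ elements) (Inverse.strictlyInverseʳ finite x)
    (∈-map⁺ _ (∈-allFin (Inverse.to finite x)))

  tuples : ∀ n → List (Vec Carrier n)
  tuples = vectors elements

  length-tuples : ∀ n → length (tuples n) ≡ q ^ n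
  length-tuples n = trans (length-vectors elements n) (cong (_^ n) length-elements)

  ∈-tuples : (v : Vec Carrier n) → v ∈ tuples n
  ∈-tuples = ∈-vectors ∈-elements

  tuples-unique : ∀ n → Unique (tuples n)
  tuples-unique = vectors-unique elements-unique

  -- The distinct elements `0#` and `1#` have distinct images in `Fin q`.
  1<q : 1 < q
  1<q = Fin-size (λ eq → 0≢1 (trans (sym (Inverse.strictlyInverseʳ finite 0#))
                   (trans (cong (Inverse.from finite) eq) (Inverse.strictlyInverseʳ finite 1#))))
    where
    Fin-size : ∀ {n} {i j : Fin n} → i ≢ j → 1 < n
    Fin-size {suc zero}    {Fin.zero} {Fin.zero} i≢j = contradiction refl i≢j
    Fin-size {suc (suc n)} _ = s≤s (s≤s z≤n)

  -- Steinitz's inequality by counting instead of exchange: the q^k combinations of `us` are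
  -- distinct, and each is determined by its m coordinates with respect to `vs`, so q^k ≤ q^m.
  independent-size-≤ : ∀ {us : Vec (Row F n) k} {vs : Vec (Row F n) m} →
    LinearlyIndependent F us → All (InSpan F vs) us → k ≤ m
  independent-size-≤ {k = k} {m} {us} {vs} ind us∈ = ℕ.≮⇒≥ λ m<k →
    ℕ.<⇒≱ (ℕ.^-monoʳ-< q 1<q m<k) q^k≤q^m
    where
    coordinates : ∀ cs → InSpan F vs (L cs us)
    coordinates cs = InSpan-trans us∈ (cs , refl)

    injective : ∀ {cs ds} → proj₁ (coordinates cs) ≡ proj₁ (coordinates ds) → cs ≡ ds
    injective {cs} {ds} eq = LinearlyIndependent⇒injective ind cs ds
      (trans (sym (proj₂ (coordinates cs)))
        (trans (cong (λ es → L es vs) eq) (proj₂ (coordinates ds))))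

    q^k≤q^m : q ^ k ≤ q ^ m
    q^k≤q^m = begin
      q ^ k                                     ≡⟨ length-tuples k ⟨
      length (tuples k)                         ≡⟨ length-map _ (tuples k) ⟨
      length (map (proj₁ ∘ coordinates) (tuples k))
        ≤⟨ Unique-⊆⇒length-≤ (map⁺ injective (tuples-unique k)) (λ {cs} _ → ∈-tuples cs) ⟩
      length (tuples m)                         ≡⟨ length-tuples m ⟩
      q ^ m                                     ∎
      where open ℕ.≤-Reasoning

  -- Enumeration of the matrices whose rows are spanned by `r` vectors.

  addDependent : Vec Carrier r → Matrix F m n × Vec (Row F n) r →
                 Matrix F (suc m) n × Vec (Row F n) r
  addDependent cs (M , b) = L cs b ∷ M , b

  addGenerator : Row F n → Matrix F m n × Vec (Row F n) r →
                 Matrix F (suc m) n × Vec (Row F n) (suc r)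
  addGenerator v (M , b) = v ∷ M , v ∷ b

  -- Each matrix is paired with r vectors spanning its rows.
  bounded : ∀ m n r → List (Matrix F m n × Vec (Row F n) r)
  bounded m       n zero    = [ replicate m 𝟎 , [] ]
  bounded zero    n (suc r) = []
  bounded (suc m) n (suc r) =
    cartesianProductWith addDependent (tuples (suc r)) (bounded m n (suc r)) ++
    cartesianProductWith addGenerator (tuples n) (bounded m n r)

  -- A dependent row contributes a factor q^(r+1), a new generator a factor q^n. With one q^n pulled
  -- out for each generator, the recursion left over is that of `q-binomial`.
  length-bounded : ∀ m n r → length (bounded m n r) ≡ (q ^ n) ^ r * q-binomial q m r
  length-bounded m       n zero    = refl
  length-bounded zero    n (suc r) = sym (ℕ.*-zeroʳ ((q ^ n) ^ suc r))
  length-bounded (suc m) n (suc r) = begin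
    length (bounded (suc m) n (suc r))
      ≡⟨ length-++ (cartesianProductWith _ (tuples (suc r)) (bounded m n (suc r))) ⟩
    length (cartesianProductWith _ (tuples (suc r)) (bounded m n (suc r))) +
    length (cartesianProductWith _ (tuples n) (bounded m n r))
      ≡⟨ cong₂ _+_ (length-cartesianProductWith _ (tuples (suc r)) (bounded m n (suc r)))
                   (length-cartesianProductWith _ (tuples n) (bounded m n r)) ⟩
    length (tuples (suc r)) * length (bounded m n (suc r)) +
    length (tuples n) * length (bounded m n r)
      ≡⟨ cong₂ _+_ (cong₂ _*_ (length-tuples (suc r)) (length-bounded m n (suc r)))
                   (cong₂ _*_ (length-tuples n) (length-bounded m n r)) ⟩
    q ^ suc r * (X * X ^ r * q-binomial q m (suc r)) + X * (X ^ r * q-binomial q m r)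
      ≡⟨ collect (q ^ suc r) X (X ^ r) (q-binomial q m (suc r)) (q-binomial q m r) ⟩
    X * X ^ r * (q ^ suc r * q-binomial q m (suc r) + q-binomial q m r) ∎
    where
    open ≡-Reasoning
    X = q ^ n
    collect : ∀ p x y a b → p * (x * y * a) + x * (y * b) ≡ x * y * (p * a + b)
    collect = solve-∀

  -- Induction on the rows. The given vectors `us` only witness that the dimension is at most `r`;
  -- the generators `b` found are in general others, chosen to agree with the enumeration. The bound
  -- r ≤ m matters because every generator listed by `bounded` is one of the rows.
  ¬¬-∈-bounded : ∀ (M : Matrix F m n) {us : Vec (Row F n) k} → All (InSpan F us) M →
    k ≤ r → r ≤ m → ¬ ¬ ∃ λ b → All (InSpan F b) M × (M , b) ∈ bounded m n r
  ¬¬-∈-bounded {r = zero} M {[]} M∈ z≤n _ = pure ([] , M∈ , here (cong (_, []) (zero-rows M∈)))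
    where
    zero-rows : ∀ {m n} {M : Matrix F m n} → All (InSpan F []) M → M ≡ replicate m 𝟎
    zero-rows []                = refl
    zero-rows (([] , refl) ∷ M) = cong (𝟎 ∷_) (zero-rows M)
  ¬¬-∈-bounded {m = suc m} {n} {r = suc r} (v ∷ M) (v∈ ∷ M∈) k≤1+r (s≤s r≤m) =
    ¬¬-excluded-middle >>= λ where
      (yes v∈M) → case ℕ.m≤n⇒m<n∨m≡n r≤m of λ where
        (inj₁ r<m) → do
          (b , M∈b , ∈bounded) ← ¬¬-∈-bounded M M∈ k≤1+r r<m
          let (cs , eq) = InSpan-trans M∈b v∈M
          pure (b , (cs , eq) ∷ M∈b , ∈-++⁺ˡ
            (subst (λ w → (w ∷ M , b) ∈ dependent) eq
              (∈-cartesianProductWith⁺ addDependent (∈-tuples cs) ∈bounded)))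
        -- Only `r` rows remain, too few for r + 1 generators. They span themselves, so `v` is
        -- recorded as a generator although it is dependent on them.
        (inj₂ refl) → enlarge (rows-InSpan M) ℕ.≤-refl
      -- Removing `v` lowers the dimension: a basis of the remaining rows together with `v` is
      -- independent inside the span of `us`, so k′ + 1 ≤ k and the remaining rows need at most `r`
      -- generators.
      (no v∉M) → do
        (k′ , b′ , ind , M⇔b′) ← ¬¬-HasRank M
        let b′∈M = All.map (λ {w} → Equivalence.from (M⇔b′ w)) (rows-InSpan b′)
            1+k′≤k = independent-size-≤
              (LinearlyIndependent-∷ (v∉M ∘ Equivalence.from (M⇔b′ v)) ind)
              (v∈ ∷ All.map (InSpan-trans M∈) b′∈M)
        enlarge (All.map (λ {w} → Equivalence.to (M⇔b′ w)) (rows-InSpan M))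
          (ℕ.s≤s⁻¹ (ℕ.≤-trans 1+k′≤k k≤1+r))
    where
    dependent = cartesianProductWith addDependent (tuples (suc r)) (bounded m n (suc r))

    enlarge : ∀ {k} {us : Vec (Row F n) k} → All (InSpan F us) M → k ≤ r →
      ¬ ¬ ∃ λ b → All (InSpan F b) (v ∷ M) × (v ∷ M , b) ∈ bounded (suc m) n (suc r)
    enlarge M∈us k≤r = do
      (b , M∈b , ∈bounded) ← ¬¬-∈-bounded M M∈us k≤r r≤m
      pure (v ∷ b , InSpan-here v b ∷ All.map (InSpan-there v) M∈b ,
        ∈-++⁺ʳ _ (∈-cartesianProductWith⁺ _ (∈-tuples v) ∈bounded))

  -- Covering the matrix space by balls around the codewords.

  subtract-subtract : (A Y : Matrix F m n) → subtract F A (subtract F A Y) ≡ Y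
  subtract-subtract []      []      = refl
  subtract-subtract (u ∷ A) (v ∷ Y) = cong₂ _∷_ (row u v) (subtract-subtract A Y)
    where
    open ≡-Reasoning
    element : ∀ x y → x +ᶠ -ᶠ (x +ᶠ -ᶠ y) ≡ y
    element x y = begin
      x +ᶠ -ᶠ (x +ᶠ -ᶠ y)      ≡⟨ cong (x +ᶠ_) (-‿+-comm x (-ᶠ y)) ⟨
      x +ᶠ (-ᶠ x +ᶠ -ᶠ -ᶠ y)   ≡⟨ +-assoc x (-ᶠ x) (-ᶠ -ᶠ y) ⟨
      (x +ᶠ -ᶠ x) +ᶠ -ᶠ -ᶠ y   ≡⟨ cong₂ _+ᶠ_ (-‿inverseʳ x) (-‿involutive y) ⟩
      0# +ᶠ y                  ≡⟨ +-identityˡ y ⟩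
      y                        ∎
    row : ∀ {n} (u v : Row F n) →
      zipWith (λ x y → x +ᶠ -ᶠ y) u (zipWith (λ x y → x +ᶠ -ᶠ y) u v) ≡ v
    row []      []      = refl
    row (x ∷ u) (y ∷ v) = cong₂ _∷_ (element x y) (row u v)

  -- The covering radius bounds only those distances that are attained as minima. For a given `Y`
  -- the codeword `A` supplies one rank, so a least rank exists up to double negation, and
  -- maximality of `ρ` then applies to it.
  ¬¬-near-codeword : ∀ {C : Code F m n} {ρ A} → C A → IsCoveringRadius F C ρ → ∀ Y →
    ¬ ¬ ∃₂ λ A r → C A × HasRank F (subtract F A Y) r × r ≤ ρ
  ¬¬-near-codeword {C = C} {A = A} A∈C (_ , ρ-max) Y = do
    (r , rank) ← ¬¬-HasRank (subtract F A Y)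
    (d , (A′ , A′∈C , rank′) , d-min) ←
      ¬¬-least {P = λ r → ∃ λ A → C A × HasRank F (subtract F A Y) r} r (A , A∈C , rank)
    pure (A′ , d , A′∈C , rank′ , ρ-max d (Y , (A′ , A′∈C , rank′) , d-min))

  sphere-covering : ∀ {C : Code F m n} {N ρ A} → C A → HasSize C N → IsCoveringRadius F C ρ →
    ρ ≤ m → (q ^ n) ^ m ≤ N * ((q ^ n) ^ ρ * q-binomial q m ρ)
  sphere-covering {m = m} {n} {C} {N} {ρ} A∈C (codewords , _ , refl , C⇔) covering ρ≤m = begin
    (q ^ n) ^ m
      ≡⟨ cong (_^ m) (length-tuples n) ⟨
    length (tuples n) ^ m
      ≡⟨ length-vectors (tuples n) m ⟨
    length matrices
      ≤⟨ Unique-⊆⇒length-≤ (vectors-unique (tuples-unique n) m) (λ {Y} _ → covered Y) ⟩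
    length balls
      ≡⟨ length-cartesianProductWith _ codewords (bounded m n ρ) ⟩
    length codewords * length (bounded m n ρ)
      ≡⟨ cong (length codewords *_) (length-bounded m n ρ) ⟩
    length codewords * ((q ^ n) ^ ρ * q-binomial q m ρ) ∎
    where
    open ℕ.≤-Reasoning
    open DecMembership (≡-dec (≡-dec _≟_)) using (_∈?_)

    matrices = vectors (tuples n) m

    -- Overlapping balls give repetitions in this list. They are harmless, since only `matrices` has
    -- to be duplicate-free.
    balls : List (Matrix F m n)
    balls = cartesianProductWith (λ A M → subtract F A (proj₁ M)) codewords (bounded m n ρ)

    covered : ∀ Y → Y ∈ balls
    covered Y = decidable-stable (Y ∈? balls) do
      (A , r , A∈C , (b , _ , M⇔b) , r≤ρ) ← ¬¬-near-codeword A∈C covering Y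
      (b , _ , ∈bounded) ← ¬¬-∈-bounded (subtract F A Y)
        (All.map (λ {w} → Equivalence.to (M⇔b w)) (rows-InSpan (subtract F A Y))) r≤ρ ρ≤m
      pure (subst (_∈ balls) (subtract-subtract A Y)
        (∈-cartesianProductWith⁺ _ (Equivalence.to (C⇔ A) A∈C) ∈bounded))

-- From cuts and logarithms to inequalities between natural numbers.

^-cancelˡ-< : ∀ {m n} o → m ^ o < n ^ o → m < n
^-cancelˡ-< o m^o<n^o = ℕ.≰⇒> λ n≤m → ℕ.<⇒≱ m^o<n^o (ℕ.^-monoˡ-≤ o n≤m)

-- A rational above the logarithm of a positive `n` has a nonnegative numerator: otherwise a product
-- of two positive naturals would be less than 1. The exponent is `suc b` because `mkℚᵘ` stores the
-- denominator minus one.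
PowerAbove⇒< : ∀ {q n} .{{_ : NonZero q}} .{{_ : NonZero n}} r → PowerAbove q n r →
  ∃₂ λ a b → r ≡ mkℚᵘ (+ a) b × n ^ suc b < q ^ a
PowerAbove⇒< (mkℚᵘ (+ a) b) n^b<q^a = a , b , refl , n^b<q^a
PowerAbove⇒< {q} {n} (mkℚᵘ -[1+ a ] b) above =
  contradiction above (ℕ.≤⇒≯ (ℕ.*-mono-≤ (ℕ.m^n>0 n (suc b)) (ℕ.m^n>0 q (suc a))))

-- Both power inequalities are raised to the common exponent (c+1)(d+1) and multiplied. Strictness
-- comes from the sum of the two rationals being less than `k`, so the bound on `n` may be weak.
product<power : ∀ {q m n} a c b d k .{{_ : NonZero m}} →
  m ^ suc c < q ^ a → n ^ suc d ≤ q ^ b →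
  mkℚᵘ (+ a) c ℚ.+ mkℚᵘ (+ b) d ℚ.< + k ℚ./ 1 → m * n < q ^ k
product<power {q} {m} {n} a c b d k m^c<q^a n^d≤q^b sum<k =
  ^-cancelˡ-< (suc c * suc d) (begin-strict
    (m * n) ^ (suc c * suc d)
      ≡⟨ ^-distribʳ-* m n (suc c * suc d) ⟩
    m ^ (suc c * suc d) * n ^ (suc c * suc d)
      ≡⟨ cong₂ _*_ (ℕ.^-*-assoc m (suc c) (suc d))
          (trans (ℕ.^-*-assoc n (suc d) (suc c)) (cong (n ^_) (ℕ.*-comm (suc d) (suc c)))) ⟨
    (m ^ suc c) ^ suc d * (n ^ suc d) ^ suc c
      ≤⟨ ℕ.*-mono-≤ (ℕ.^-monoˡ-≤ (suc d) (ℕ.<⇒≤ m^c<q^a)) (ℕ.^-monoˡ-≤ (suc c) n^d≤q^b) ⟩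
    (q ^ a) ^ suc d * (q ^ b) ^ suc c
      ≡⟨ cong₂ _*_ (ℕ.^-*-assoc q a (suc d)) (ℕ.^-*-assoc q b (suc c)) ⟩
    q ^ (a * suc d) * q ^ (b * suc c)
      ≡⟨ ℕ.^-distribˡ-+-* q (a * suc d) (b * suc c) ⟨
    q ^ (a * suc d + b * suc c)
      <⟨ ℕ.^-monoʳ-< q 1<q exponents ⟩
    q ^ (k * (suc c * suc d))
      ≡⟨ ℕ.^-*-assoc q k (suc c * suc d) ⟨
    (q ^ k) ^ (suc c * suc d) ∎)
  where
  open ℕ.≤-Reasoning
  exponents : a * suc d + b * suc c < k * (suc c * suc d)
  exponents = ℤ.drop‿+<+ (subst₂ ℤ._<_
    (trans (ℤ.*-identityʳ _) (trans
      (cong₂ ℤ._+_ (sym (ℤ.pos-* a (suc d))) (sym (ℤ.pos-* b (suc c))))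
      (sym (ℤ.pos-+ (a * suc d) (b * suc c)))))
    (sym (ℤ.pos-* k (suc c * suc d)))
    (ℚ.drop-*<* sum<k))
  -- For q ≤ 1 the power q^a would be at most 1 and could not exceed the positive m^(c+1).
  1<q : 1 < q
  1<q = ℕ.≰⇒> λ q≤1 → ℕ.<⇒≱ m^c<q^a (ℕ.≤-trans (ℕ.^-monoˡ-≤ a q≤1)
    (ℕ.≤-trans (ℕ.≤-reflexive (ℕ.^-zeroˡ a)) (ℕ.m^n>0 m (suc c))))

+-transpose-< : ∀ {x y t u} → x ℚ.< y → y ℚ.≃ t ℚ.+ u → x ℚ.+ ℚ.- u ℚ.< t
+-transpose-< {x} {y} {t} {u} x<y y≃t+u = begin-strict
  x ℚ.+ ℚ.- u            <⟨ ℚ.+-monoˡ-< (ℚ.- u) x<y ⟩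
  y ℚ.+ ℚ.- u            ≃⟨ ℚ.+-congˡ (ℚ.- u) y≃t+u ⟩
  t ℚ.+ u ℚ.+ ℚ.- u      ≃⟨ ℚ.+-assoc t u (ℚ.- u) ⟩
  t ℚ.+ (u ℚ.+ ℚ.- u)    ≃⟨ ℚ.+-congʳ t (ℚ.+-inverseʳ u) ⟩
  t ℚ.+ 0ℚᵘ              ≃⟨ ℚ.+-identityʳ t ⟩
  t                      ∎
  where open ℚ.≤-Reasoning

module _ {q : ℕ} .{{_ : NonZero q}} (N : ℕ) .{{_ : NonZero N}}
         {s : Cut} (s≃ : s ≃ᶜ log q N) where

  upper-s : ∀ {r} → upper s r → ∃₂ λ a b → r ≡ mkℚᵘ (+ a) b × N ^ suc b < q ^ a
  upper-s {r} r∈ = PowerAbove⇒< r (Equivalence.to (proj₂ (s≃ r)) r∈)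

  -- Unfolding the cuts gives rationals `x` above `s` and `y` above log_q n with x + y < t < k, the
  -- input of `product<power`.
  0<k-[s+log]⇒< : ∀ n .{{_ : NonZero n}} {k} →
    fromℕ 0 <ᶜ fromℕ k -ᶜ (s +ᶜ log q n) → N * n < q ^ k
  0<k-[s+log]⇒< n {k} (r , 0<r , t , u , t<k , (x , y , x∈ , y∈ , -u≃) , r≃)
    with a , c , refl , N^c<q^a ← upper-s x∈
       | b , d , refl , n^d<q^b ← PowerAbove⇒< y y∈
    = product<power a c b d k N^c<q^a (ℕ.<⇒≤ n^d<q^b) (begin-strict
      x ℚ.+ y         ≃⟨ -u≃ ⟨
      ℚ.- u           ≃⟨ ℚ.+-identityˡ (ℚ.- u) ⟨
      0ℚᵘ ℚ.+ ℚ.- u   <⟨ +-transpose-< 0<r r≃ ⟩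
      t               <⟨ t<k ⟩
      + k ℚ./ 1       ∎)
    where open ℚ.≤-Reasoning

  -- The assumption provides a positive rational w above √(s+1) with ρ + w < m. Hence ρ < m and w <
  -- d for d = m - ρ, so s + 1 < w² < d², and exponentiating with base `q` gives the claim.
  <m-√[s+1]⇒< : ∀ {ρ m} → fromℕ ρ <ᶜ fromℕ m -ᶜ √ᶜ (s +ᶜ fromℕ 1) →
    ρ < m × N * q < q ^ ((m ∸ ρ) ^ 2)
  <m-√[s+1]⇒< {ρ} {m}
    (r , ρ<r , t , u , t<m , (0<w , x , y , x∈ , 1<y , w²≃) , r≃)
    with a , c , refl , N^c<q^a ← upper-s x∈
    -- The factor `q` enters with its exact logarithm 1/1, for which the required bound q^1 ≤ q^1 is
    -- an equality.
    = ρ<m , product<power a c 1 0 ((m ∸ ρ) ^ 2) N^c<q^a (ℕ.≤-refl {q ^ 1}) (begin-strict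
      x ℚ.+ + 1 ℚ./ 1              <⟨ ℚ.+-monoʳ-< x 1<y ⟩
      x ℚ.+ y                      ≃⟨ w²≃ ⟨
      w ℚ.* w                      <⟨ ℚ.*-mono-<-nonNeg w<d w<d ⟩
      (+ d ℚ./ 1) ℚ.* (+ d ℚ./ 1)  ≡⟨ cong (λ z → mkℚᵘ z 0) (ℤ.pos-* d d) ⟨
      + (d * d) ℚ./ 1              ≡⟨ cong (λ z → + (d * z) ℚ./ 1) (ℕ.*-identityʳ d) ⟨
      + (d ^ 2) ℚ./ 1              ∎)
    where
    open ℚ.≤-Reasoning
    w = ℚ.- u
    d = m ∸ ρ
    instance _ = ℚ.nonNegative (ℚ.<⇒≤ 0<w)

    ρ+w<m : + ρ ℚ./ 1 ℚ.+ w ℚ.< + m ℚ./ 1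
    ρ+w<m = ℚ.<-trans (+-transpose-< ρ<r r≃) t<m

    ρ<m : ρ < m
    ρ<m = ℤ.drop‿+<+ (subst₂ ℤ._<_ (ℤ.*-identityʳ (+ ρ)) (ℤ.*-identityʳ (+ m))
      (ℚ.drop-*<* (begin-strict
        + ρ ℚ./ 1            ≃⟨ ℚ.+-identityʳ (+ ρ ℚ./ 1) ⟨
        + ρ ℚ./ 1 ℚ.+ 0ℚᵘ    <⟨ ℚ.+-monoʳ-< (+ ρ ℚ./ 1) 0<w ⟩
        + ρ ℚ./ 1 ℚ.+ w      <⟨ ρ+w<m ⟩
        + m ℚ./ 1            ∎)))

    w<d : w ℚ.< + d ℚ./ 1
    w<d = ℚ.≰⇒> λ d≤w → ℚ.<⇒≱ ρ+w<m (begin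
      + m ℚ./ 1
        ≡⟨ cong (λ z → + z ℚ./ 1) (ℕ.m+[n∸m]≡n (ℕ.<⇒≤ ρ<m)) ⟨
      + (ρ + d) ℚ./ 1
        ≡⟨ cong (λ z → mkℚᵘ z 0) (cong₂ ℤ._+_ (ℤ.*-identityʳ (+ ρ)) (ℤ.*-identityʳ (+ d))) ⟨
      + ρ ℚ./ 1 ℚ.+ + d ℚ./ 1
        ≤⟨ ℚ.+-monoʳ-≤ (+ ρ ℚ./ 1) d≤w ⟩
      + ρ ℚ./ 1 ℚ.+ w ∎)

-- The covering inequality in terms of exponents, and the bounds on the radius.

HasSize-inhabited : ∀ {A : Set} {P : A → Set} {n} → 1 ≤ n → HasSize P n → ∃ P
HasSize-inhabited _  (x ∷ _ , _ , _    , P⇔) = x , Equivalence.from (P⇔ x) (here refl)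
HasSize-inhabited () ([]    , _ , refl , _)

-- The dimensions are written as ρ + d and ρ + d + e to avoid truncated subtraction. With n = ρ + d
-- + e, cancelling q^(nρ + dρ) from both sides leaves the exponent n(ρ + d) - nρ - dρ = d² + ed.
power-bound : ∀ {q} N ρ d e → 2 ≤ q →
  (q ^ (ρ + d + e)) ^ (ρ + d) ≤ N * ((q ^ (ρ + d + e)) ^ ρ * q-binomial q (ρ + d) ρ) →
  q ^ (d ^ 2 + e * d) ≤ N * 4
power-bound {q} N ρ d e 2≤q covering =
  ℕ.*-cancelˡ-≤ (q ^ (n * ρ + d * ρ)) (begin
    q ^ (n * ρ + d * ρ) * q ^ (d ^ 2 + e * d)
      ≡⟨ ℕ.^-distribˡ-+-* q (n * ρ + d * ρ) (d ^ 2 + e * d) ⟨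
    q ^ (n * ρ + d * ρ + (d ^ 2 + e * d))
      ≡⟨ cong (q ^_) (exponents ρ d e) ⟩
    q ^ (n * (ρ + d))
      ≡⟨ ℕ.^-*-assoc q n (ρ + d) ⟨
    (q ^ n) ^ (ρ + d)
      ≤⟨ covering ⟩
    N * ((q ^ n) ^ ρ * q-binomial q (ρ + d) ρ)
      ≤⟨ ℕ.*-monoʳ-≤ N (ℕ.*-monoʳ-≤ ((q ^ n) ^ ρ) (q-binomial≤ 2≤q ρ d)) ⟩
    N * ((q ^ n) ^ ρ * (4 * q ^ (d * ρ)))
      ≡⟨ cong (λ x → N * (x * (4 * q ^ (d * ρ)))) (ℕ.^-*-assoc q n ρ) ⟩
    N * (q ^ (n * ρ) * (4 * q ^ (d * ρ)))
      ≡⟨ regroup N (q ^ (n * ρ)) (q ^ (d * ρ)) ⟩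
    q ^ (n * ρ) * q ^ (d * ρ) * (N * 4)
      ≡⟨ cong (_* (N * 4)) (ℕ.^-distribˡ-+-* q (n * ρ) (d * ρ)) ⟨
    q ^ (n * ρ + d * ρ) * (N * 4) ∎)
  where
  open ℕ.≤-Reasoning
  n = ρ + d + e
  instance
    _ = >-nonZero (ℕ.<-trans z<s 2≤q)
    _ = ℕ.m^n≢0 q (n * ρ + d * ρ)
  exponents : ∀ ρ d e → (ρ + d + e) * ρ + d * ρ + (d * (d * 1) + e * d) ≡ (ρ + d + e) * (ρ + d)
  exponents = solve-∀
  regroup : ∀ N x y → N * (x * (4 * y)) ≡ x * y * (N * 4)
  regroup = solve-∀

covering-bound : ∀ {q} (F : FiniteField q) {m m′} → m ≤ m′ →
  ∀ {C : Code F m m′} {N} → HasSize C N → 1 ≤ N →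
  ∀ {ρ} → IsCoveringRadius F C ρ → ρ ≤ m →
  q ^ ((m ∸ ρ) ^ 2 + (m′ ∸ m) * (m ∸ ρ)) ≤ N * 4
covering-bound {q} F {m} {m′} m≤m′ {N = N} size 1≤N {ρ} radius ρ≤m =
  power-bound N ρ (m ∸ ρ) (m′ ∸ m) 1<q
  (subst₂ (λ m n → (q ^ n) ^ m ≤ N * ((q ^ n) ^ ρ * q-binomial q m ρ))
    (sym ρ+d≡m) (sym (trans (cong (_+ (m′ ∸ m)) ρ+d≡m) (ℕ.m+[n∸m]≡n m≤m′)))
    (sphere-covering (proj₂ (HasSize-inhabited 1≤N size)) size radius ρ≤m))
  where
  open LinearAlgebra F
  ρ+d≡m = ℕ.m+[n∸m]≡n ρ≤m

theorem6p7 : ∀ (q : ℕ) → IsPrimePower q → (F : FiniteField q) →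
    ∀ (m m' : ℕ) → 1 ≤ m → m ≤ m' →
    ∀ (C : Code F m m') (N : ℕ) → HasSize C N → 2 ≤ N →
    ∀ (s : Cut) → s ≃ᶜ log q N →
    IsMinimumDistance F C m →
    ∀ (ρ : ℕ) → IsCoveringRadius F C ρ →
    (∀ (h : ℕ) →
    IsMin (λ k → fromℕ 0 <ᶜ fromℕ ((k + 1) ^ 2 + (m' ∸ m) * (k + 1)) -ᶜ (s +ᶜ log q 4)) h →
    + m -ℤ + h ≤ℤ + ρ)
    ×
    (q ≢ 2 → q ≢ 3 → fromℕ m -ᶜ √ᶜ (s +ᶜ fromℕ 1) ≤ᶜ fromℕ ρ)
theorem6p7 q _ F m m' _ m≤m' C N size 2≤N s s≃ _ ρ radius = part₁ , part₂
  where
  open LinearAlgebra F using (1<q)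
  open ℕ.≤-Reasoning
  1≤N = ℕ.<⇒≤ 2≤N
  instance
    _ = >-nonZero (ℕ.<⇒≤ 1<q)
    _ = >-nonZero 1≤N
  d = m ∸ ρ
  e = m' ∸ m

  bound : ρ ≤ m → q ^ (d ^ 2 + e * d) ≤ N * 4
  bound = covering-bound F m≤m' size 1≤N radius

  part₁ : ∀ h → IsMin _ h → + m -ℤ + h ≤ℤ + ρ
  -- The chain m ≤ ρ + d ≤ ρ + h, followed by subtraction of `h` in the integers.
  part₁ h (positive , _) = subst₂ _≤ℤ_ (sym (ℤ.m-n≡m⊖n m h)) ρ+h⊖h≡ρ
    (ℤ.⊖-monoˡ-≤ h (ℕ.≤-trans (ℕ.m≤n+m∸n m ρ) (ℕ.+-monoʳ-≤ ρ d≤h)))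
    where
    ρ+h⊖h≡ρ : ρ + h ℤ.⊖ h ≡ + ρ
    ρ+h⊖h≡ρ = trans (ℤ.⊖-≥ (ℕ.m≤n+m h ρ)) (cong +_ (ℕ.m+n∸n≡m ρ h))

    -- If h + 1 ≤ d, the strict inequality N * 4 < q^((h+1)² + e(h+1)) carries over to the larger
    -- exponent d² + ed and contradicts `bound`.
    d≤h : d ≤ h
    d≤h = ℕ.≮⇒≥ λ h<d → ℕ.<⇒≱ (0<k-[s+log]⇒< N s≃ 4 positive) (begin
      q ^ ((h + 1) ^ 2 + e * (h + 1))
        ≤⟨ ℕ.^-monoʳ-≤ q (exponent-mono (subst (_≤ d) (ℕ.+-comm 1 h) h<d)) ⟩
      q ^ (d ^ 2 + e * d)
        -- Since h < d, the truncated difference `d` is nonzero, which gives the inequality ρ ≤ m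
        -- required by `bound`.
        ≤⟨ bound (ℕ.<⇒≤ (ℕ.m∸n≢0⇒n<m (ℕ.m<n⇒n≢0 h<d))) ⟩
      N * 4 ∎)
      where
      exponent-mono : ∀ {i j} → i ≤ j → i ^ 2 + e * i ≤ j ^ 2 + e * j
      exponent-mono i≤j = ℕ.+-mono-≤ (ℕ.^-monoˡ-≤ 2 i≤j) (ℕ.*-monoʳ-≤ e i≤j)

  part₂ : q ≢ 2 → q ≢ 3 → fromℕ m -ᶜ √ᶜ (s +ᶜ fromℕ 1) ≤ᶜ fromℕ ρ
  part₂ q≢2 q≢3 below with ρ<m , Nq<q^d² ← <m-√[s+1]⇒< N s≃ below =
    ℕ.<⇒≱ Nq<q^d² (begin
      q ^ (d ^ 2)           ≤⟨ ℕ.^-monoʳ-≤ q (ℕ.m≤m+n (d ^ 2) (e * d)) ⟩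
      q ^ (d ^ 2 + e * d)   ≤⟨ bound (ℕ.<⇒≤ ρ<m) ⟩
      -- Replacing 4 by `q` is what turns log_q 4 into the summand 1 under the root.
      N * 4                 ≤⟨ ℕ.*-monoʳ-≤ N 4≤q ⟩
      N * q                 ∎)
    where
    4≤q : 4 ≤ q
    4≤q = ℕ.≤∧≢⇒< (ℕ.≤∧≢⇒< 1<q (≢-sym q≢2)) (≢-sym q≢3)
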